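{- Let $m\ge 2$ be an even integer and $n$ a positive integer with $n\equiv 0\pmod 4$. Then there exists a cyclic and $\phi_n$-symmetric hamiltonian cycle system of $K_{m\times n}$.
   Context: $K_{m\times n}$ is the complete multipartite graph with $m$ parts of size $n$, with vertex set identified with $\mathbb{Z}_{mn}$, parts the cosets of $m\mathbb{Z}_{mn}$, and $x,y$ adjacent iff $x-y\notin m\mathbb{Z}_{mn}$. A hamiltonian cycle system is a set of hamiltonian cycles whose edge sets partition the edge set; it is cyclic if it is closed under adding $1$ to all vertices of a cycle. $\phi_n$ is the map $x\mapsto x+m$ on $\mathbb{Z}_{mn}$; the system is $\phi_n$-symmetric if each of its cycles is mapped to itself by $\phi_n$. -}

module Defs where

open import Data.Nat using (ℕ; zero; suc; _+_; _*_; ∣_-_∣)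
open import Data.Nat.DivMod using (_%_; m%n<n)
open import Data.Nat.Divisibility using (_∣_)
open import Data.Fin using (Fin; toℕ; fromℕ<)
open import Data.Product using (Σ; ∃; _×_)
open import Data.Sum using (_⊎_)
open import Relation.Nullary using (¬_)
open import Relation.Binary.PropositionalEquality using (_≡_)
open import Function using (_⇔_)
open import Function.Definitions using (Injective)

shift : {N : ℕ} → ℕ → Fin N → Fin N
shift {zero} k ()
shift {suc N} k x = fromℕ< (m%n<n (toℕ x + k) (suc N))

Vtx : ℕ → ℕ → Set
Vtx m n = Fin (m * n)

-- x, y adjacent in K_{m×n} iff x - y ∉ mZ_{mn}, i.e. m does not divide |x - y|
-- (since m ∣ mn, this is well defined on representatives).
Adj : (m n : ℕ) → Vtx m n → Vtx m n → Set
Adj m n x y = ¬ (m ∣ ∣ toℕ x - toℕ y ∣)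

record HamCycle (m n : ℕ) : Set where
  field
    seq      : Fin (m * n) → Vtx m n
    distinct : Injective _≡_ _≡_ seq
    adjacent : ∀ i → Adj m n (seq i) (seq (shift 1 i))
open HamCycle public

Edge : {m n : ℕ} → HamCycle m n → Vtx m n → Vtx m n → Set
Edge {m} {n} c x y = ∃ λ i →
  (seq c i ≡ x × seq c (shift 1 i) ≡ y) ⊎ (seq c i ≡ y × seq c (shift 1 i) ≡ x)

-- The cycle d is the image of the cycle c under x ↦ x + k
-- (cycles are identified with their edge sets).
Translate : {m n : ℕ} → ℕ → HamCycle m n → HamCycle m n → Set
Translate k c d = ∀ x y → (Edge c x y ⇔ Edge d (shift k x) (shift k y))

IsHCS : (m n r : ℕ) → (Fin r → HamCycle m n) → Set
IsHCS m n r cs = ∀ x y → Adj m n x y →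
  (∃ λ i → Edge (cs i) x y) × (∀ i j → Edge (cs i) x y → Edge (cs j) x y → i ≡ j)

IsCyclic : (m n r : ℕ) → (Fin r → HamCycle m n) → Set
IsCyclic m n r cs = ∀ i → ∃ λ j → Translate 1 (cs i) (cs j)

IsPhiSymmetric : (m n r : ℕ) → (Fin r → HamCycle m n) → Set
IsPhiSymmetric m n r cs = ∀ i → Translate m (cs i) (cs i)

{-# OPTIONS --safe #-}
-- Call f : ℕ → ℕ a base cycle of period ℓ ∣ m if f (i + ℓ) = f i + ℓ and f is injective modulo ℓ on a period.
-- Modulo N = mn it is a hamiltonian cycle fixed by x ↦ x + ℓ, hence by x ↦ x + m, and its translates f + j
-- with j < ℓ cover, once each, the edges whose difference is ± one of the ℓ differences |f (i + 1) − f i|. So it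
-- suffices to find base cycles whose differences are exactly the d < N / 2 with m ∤ d, each occurring once.
--
-- Write m = 2h, n = 4K, and c = 2km with k < K. For each k one base cycle of period m zigzags through the even
-- residues modulo m with differences c + 2, c + 4, …, c + m − 2, jumps by c + 1, zigzags through the odd residues
-- with differences c + m + 2, …, c + 2m − 2, and closes up by a jump of c + m − 1 (h even) or c + 2m − 1 (h odd).
-- The odd differences left over between c and c + 2m split into pairs d, d + 2, and the sequence
-- 0, d + 2, 2, d + 4, 4, … is a base cycle of period 2 with differences d + 2 and d.
module Submission where

open import Defs
open import Data.Bool using (Bool; true; false; not; if_then_else_)
open import Data.Nat using (ℕ; zero; suc; _+_; _*_; _∸_; _≤_; _<_; z≤n; s≤s; s≤s⁻¹; NonZero; >-nonZero; ∣_-_∣)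
open import Data.Nat.Properties
open import Data.Nat.DivMod using (_%_; _/_; m%n<n; m≡m%n+[m/n]*n; [m+kn]%n≡m%n; m<n⇒m%n≡m; m<n⇒m/n≡0; +-distrib-/-∣ʳ; m*n/n≡m; m<n*o⇒m/o<n)
open import Data.Nat.Divisibility using (_∣_; divides; divides-refl; ∣-trans; ∣-refl; m∣m*n; ∣m∣n⇒∣m+n; ∣m+n∣m⇒∣n; _∣0; n∣m*n; *-cancelʳ-∣; >⇒∤)
open import Data.Nat.Tactic.RingSolver using (solve-∀)
open import Data.Fin using (Fin; toℕ; fromℕ<; combine; zero; suc)
open import Data.Fin.Properties using (toℕ-fromℕ<; toℕ-injective; toℕ<n; toℕ-combine; combine-injective; combine-surjective; +↔⊎; *↔×)
open import Data.Product using (Σ; ∃; _×_; _,_; proj₁; proj₂; map₂)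
open import Data.Product.Function.NonDependent.Propositional using (_×-↔_)
open import Data.Sum using (_⊎_; inj₁; inj₂) renaming (swap to ⊎-swap; map to ⊎-map)
open import Data.Sum.Function.Propositional using (_⊎-↔_)
open import Relation.Nullary using (¬_; contradiction; yes; no)
open import Relation.Binary.Definitions using (Tri; tri<; tri≈; tri>)
open import Relation.Binary.PropositionalEquality using (_≡_; _≢_; refl; sym; trans; cong; cong₂; subst; subst₂; module ≡-Reasoning)
open import Function using (mk⇔; _↔_; mk↔ₛ′; Inverse)
open import Function.Construct.Composition using (_↔-∘_)
open import Function.Construct.Identity using (↔-id)

-- Congruence of natural numbers.

infix 4 _≈_[_]

-- Congruence without subtraction: a multiple of `N` may be added on either side. Being a record, it
-- lets `a`, `b` and `N` be inferred from the type of a proof.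
record _≈_[_] (a b N : ℕ) : Set where
  constructor offset
  field
    k l      : ℕ
    balanced : a + k * N ≡ b + l * N

≡⇒≈ : ∀ {a b N} → a ≡ b → a ≈ b [ N ]
≡⇒≈ refl = offset 0 0 refl

≈-refl : ∀ {a N} → a ≈ a [ N ]
≈-refl = ≡⇒≈ refl

≈-sym : ∀ {a b N} → a ≈ b [ N ] → b ≈ a [ N ]
≈-sym (offset k l eq) = offset l k (sym eq)

≈-+ : ∀ {a b c d N} → a ≈ b [ N ] → c ≈ d [ N ] → a + c ≈ b + d [ N ]
≈-+ {a} {b} {c} {d} {N} (offset k l eq) (offset k′ l′ eq′) = offset (k + k′) (l + l′) (begin
  a + c + (k + k′) * N       ≡⟨ lemma a c k k′ N ⟩
  (a + k * N) + (c + k′ * N) ≡⟨ cong₂ _+_ eq eq′ ⟩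
  (b + l * N) + (d + l′ * N) ≡⟨ lemma b d l l′ N ⟨
  b + d + (l + l′) * N       ∎)
  where
  open ≡-Reasoning
  lemma : ∀ a c k k′ N → a + c + (k + k′) * N ≡ (a + k * N) + (c + k′ * N)
  lemma = solve-∀

-- This is subtraction of congruences; adding the second congruence crosswise avoids negative
-- numbers. Transitivity follows by adding both congruences and cancelling the common middle term.
≈-cancelʳ : ∀ {a b c d N} → a + c ≈ b + d [ N ] → c ≈ d [ N ] → a ≈ b [ N ]
≈-cancelʳ {a} {b} {c} {d} {N} (offset k l eq) (offset k′ l′ eq′) =
  offset (k + l′) (l + k′) (+-cancelʳ-≡ (c + d) _ _ (begin
    a + (k + l′) * N + (c + d)   ≡⟨ lemma a k l′ c d N ⟩
    a + c + k * N + (d + l′ * N) ≡⟨ cong₂ _+_ eq (sym eq′) ⟩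
    b + d + l * N + (c + k′ * N) ≡⟨ lemma b l k′ d c N ⟨
    b + (l + k′) * N + (d + c)   ≡⟨ cong (b + (l + k′) * N +_) (+-comm d c) ⟩
    b + (l + k′) * N + (c + d)   ∎))
  where
  open ≡-Reasoning
  lemma : ∀ a k l c d N → a + (k + l) * N + (c + d) ≡ a + c + k * N + (d + l * N)
  lemma = solve-∀

≈-cancelˡ : ∀ {a b c d N} → c + a ≈ d + b [ N ] → c ≈ d [ N ] → a ≈ b [ N ]
≈-cancelˡ {a} {b} {c} {d} {N} p = ≈-cancelʳ (subst (_≈ b + d [ N ]) (+-comm c a) (subst (c + a ≈_[ N ]) (+-comm d b) p))

≈-trans : ∀ {a b c N} → a ≈ b [ N ] → b ≈ c [ N ] → a ≈ c [ N ]
≈-trans {a} {b} {c} {N} p q = ≈-cancelʳ (subst (a + b ≈_[ N ]) (+-comm b c) (≈-+ p q)) (≈-refl {b})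

multiple≈0 : ∀ k {N} → k * N ≈ 0 [ N ]
multiple≈0 k {N} = offset 0 k (+-identityʳ _)

∣⇒≈0 : ∀ {a N} → N ∣ a → a ≈ 0 [ N ]
∣⇒≈0 (divides k refl) = multiple≈0 k

≈-coarsen : ∀ {a b ℓ N} → ℓ ∣ N → a ≈ b [ N ] → a ≈ b [ ℓ ]
≈-coarsen {a} {b} {ℓ} (divides e refl) (offset k l eq) = offset (k * e) (l * e)
  (trans (cong (a +_) (*-assoc k e ℓ)) (trans eq (cong (b +_) (sym (*-assoc l e ℓ)))))

≈⇒≡ : ∀ {a b N} → a < N → b < N → a ≈ b [ N ] → a ≡ b
≈⇒≡ {a} {b} {N@(suc _)} a<N b<N (offset k l eq) = begin
  a               ≡⟨ m<n⇒m%n≡m a<N ⟨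
  a % N           ≡⟨ [m+kn]%n≡m%n a k N ⟨
  (a + k * N) % N ≡⟨ cong (_% N) eq ⟩
  (b + l * N) % N ≡⟨ [m+kn]%n≡m%n b l N ⟩
  b % N           ≡⟨ m<n⇒m%n≡m b<N ⟩
  b               ∎
  where open ≡-Reasoning

≈0⇒∣ : ∀ {a N} → a ≈ 0 [ N ] → N ∣ a
≈0⇒∣ {a} {N} (offset k l eq) = ∣m+n∣m⇒∣n (subst (N ∣_) (trans (sym eq) (+-comm a _)) (n∣m*n l)) (n∣m*n k)

%-≈ : ∀ a N .{{_ : NonZero N}} → a % N ≈ a [ N ]
%-≈ a N = offset (a / N) 0 (trans (sym (m≡m%n+[m/n]*n a N)) (sym (+-identityʳ a)))

-- With `N = (1 + e)ℓ`, subtracting `kℓ` is the same modulo `N` as adding `keℓ`, so the coefficient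
-- can be taken in the natural numbers.
≈-refine : ∀ {a b ℓ N} → ℓ ∣ N → 0 < N → a ≈ b [ ℓ ] → ∃ λ c → a ≈ b + c * ℓ [ N ]
≈-refine (divides zero refl) () _
≈-refine {a} {b} {ℓ} (divides (suc e) refl) _ (offset k l eq) = l + k * e , offset k 0 (begin
  a + k * (ℓ + e * ℓ)         ≡⟨ lemma a k ℓ e ⟩
  (a + k * ℓ) + k * e * ℓ     ≡⟨ cong (_+ k * e * ℓ) eq ⟩
  (b + l * ℓ) + k * e * ℓ     ≡⟨ lemma′ b l k ℓ e ⟩
  b + (l + k * e) * ℓ + 0     ∎)
  where
  open ≡-Reasoning
  lemma : ∀ a k ℓ e → a + k * (ℓ + e * ℓ) ≡ (a + k * ℓ) + k * e * ℓ
  lemma = solve-∀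
  lemma′ : ∀ b l k ℓ e → (b + l * ℓ) + k * e * ℓ ≡ b + (l + k * e) * ℓ + 0
  lemma′ = solve-∀

-- Vertices as residues modulo `N`.

-- The vertex argument is there to witness that `N` is nonzero.
reduce : ∀ {N} → Fin N → ℕ → Fin N
reduce {suc N} _ a = fromℕ< (m%n<n a (suc N))

toℕ-reduce : ∀ {N} (x : Fin N) a → toℕ (reduce x a) ≈ a [ N ]
toℕ-reduce {suc N} _ a = ≈-trans (≡⇒≈ (toℕ-fromℕ< (m%n<n a (suc N)))) (%-≈ a (suc N))

toℕ-shift : ∀ {N} k (x : Fin N) → toℕ (shift k x) ≈ toℕ x + k [ N ]
toℕ-shift {suc N} k x = toℕ-reduce x (toℕ x + k)

toℕ-≈-injective : ∀ {N} {x y : Fin N} → toℕ x ≈ toℕ y [ N ] → x ≡ y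
toℕ-≈-injective {x = x} {y} p = toℕ-injective (≈⇒≡ (toℕ<n x) (toℕ<n y) p)

∣-∣-≤ : ∀ {x y} → x ≤ y → x + ∣ x - y ∣ ≡ y
∣-∣-≤ {x} {y} x≤y = trans (cong (x +_) (m≤n⇒∣m-n∣≡n∸m x≤y)) (m+[n∸m]≡n x≤y)

∣∣-∣⇒≈ : ∀ {m} x y → m ∣ ∣ x - y ∣ → x ≈ y [ m ]
∣∣-∣⇒≈ {m} x y m∣ with ≤-total x y
... | inj₁ x≤y = ≈-trans (≡⇒≈ (sym (+-identityʳ x))) (≈-trans (≈-+ ≈-refl (≈-sym (∣⇒≈0 m∣))) (≡⇒≈ (∣-∣-≤ x≤y)))
... | inj₂ y≤x = ≈-sym (≈-trans (≡⇒≈ (sym (+-identityʳ y))) (≈-trans (≈-+ ≈-refl (≈-sym (∣⇒≈0 m∣)))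
                   (≡⇒≈ (trans (cong (y +_) (∣-∣-comm x y)) (∣-∣-≤ y≤x)))))

-- For `n = 2n′` the difference `mn / 2` is `n′m`. Hence adjacent vertices never differ by half of
-- `N`, the one difference that would be its own negative.
half-divisible : ∀ {m n} → 2 ∣ n → ∀ d → d + d ≡ m * n → m ∣ d
half-divisible {m} {n} (divides n′ n≡) d d+d≡N = divides n′ (*-cancelˡ-≡ d (n′ * m) 2 (begin
  d + (d + 0)  ≡⟨ cong (d +_) (+-identityʳ d) ⟩
  d + d        ≡⟨ d+d≡N ⟩
  m * n        ≡⟨ cong (m *_) n≡ ⟩
  m * (n′ * 2) ≡⟨ lemma m n′ ⟩
  2 * (n′ * m) ∎))
  where
  open ≡-Reasoning
  lemma : ∀ m n′ → m * (n′ * 2) ≡ 2 * (n′ * m)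
  lemma = solve-∀

-- Base cycles as abstract data.

Spans : (low len u v : ℕ) → Set
Spans low len u v = (u ≡ low × v ≡ low + len) ⊎ (u ≡ low + len × v ≡ low)

-- `Orbit` indexes the base cycles and `Step` the edges in one period of all of them. A step is
-- recorded by its lower end and its difference, whichever way the cycle runs through it. The `len`
-- fields say that steps correspond to the differences below `N / 2` not divisible by `m`.
record BaseCycles (m n : ℕ) : Set₁ where
  field
    Orbit Step        : Set
    period            : Orbit → ℕ
    period-nonZero    : ∀ b → NonZero (period b)
    period∣m          : ∀ b → period b ∣ m
    base              : Orbit → ℕ → ℕ
    base-closes       : ∀ b → base b (period b) ≡ base b 0 + period b
    base-injective    : ∀ b {i j} → i < period b → j < period b → base b i ≈ base b j [ period b ] → i ≡ j
    orbit             : Step → Orbit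
    low len           : Step → ℕ
    step-at           : ∀ b i → i < period b → ∃ λ s → orbit s ≡ b × Spans (low s) (len s) (base b i) (base b (suc i))
    position          : ∀ s → ∃ λ i → i < period (orbit s) × Spans (low s) (len s) (base (orbit s) i) (base (orbit s) (suc i))
    len-injective     : ∀ {s s′} → len s ≡ len s′ → s ≡ s′
    len-surjective    : ∀ d → ¬ m ∣ d → d + d < m * n → ∃ λ s → len s ≡ d
    len-indivisible   : ∀ s → ¬ m ∣ len s
    len-bound         : ∀ s → len s + len s < m * n

-- From base cycles to hamiltonian cycles of the whole graph.

module Develop {m n : ℕ} (2∣n : 2 ∣ n) (B : BaseCycles m n) where
  open BaseCycles B

  instance
    period≢0 : ∀ {b} → NonZero (period b)
    period≢0 {b} = period-nonZero b

  N : ℕ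
  N = m * n

  period∣N : ∀ b → period b ∣ N
  period∣N b = ∣-trans (period∣m b) (m∣m*n n)

  -- The extension of one period to all indices by the rule `f (i + ℓ) = f i + ℓ`.
  walk : Orbit → ℕ → ℕ
  walk b i = base b (i % period b) + i / period b * period b

  walk-periodic : ∀ b i c → walk b (i + c * period b) ≡ walk b i + c * period b
  walk-periodic b i c = begin
    base b ((i + c * ℓ) % ℓ) + (i + c * ℓ) / ℓ * ℓ ≡⟨ cong₂ (λ u v → base b u + v * ℓ) ([m+kn]%n≡m%n i c ℓ) quotient ⟩
    base b (i % ℓ) + (i / ℓ + c) * ℓ               ≡⟨ lemma (base b (i % ℓ)) (i / ℓ) c ℓ ⟩
    walk b i + c * ℓ                               ∎
    where
    open ≡-Reasoning
    ℓ = period b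
    quotient : (i + c * ℓ) / ℓ ≡ i / ℓ + c
    quotient = trans (+-distrib-/-∣ʳ i (divides-refl c)) (cong (i / ℓ +_) (m*n/n≡m c ℓ))
    lemma : ∀ x q c ℓ → x + (q + c) * ℓ ≡ x + q * ℓ + c * ℓ
    lemma = solve-∀

  walk-base : ∀ b {i} → i < period b → walk b i ≡ base b i
  walk-base b {i} i<ℓ = trans (cong₂ (λ u v → base b u + v * period b) (m<n⇒m%n≡m i<ℓ) (m<n⇒m/n≡0 i<ℓ)) (+-identityʳ _)

  walk-at : ∀ b {i} → i < period b → ∀ c → walk b (i + c * period b) ≡ base b i + c * period b
  walk-at b {i} i<ℓ c = trans (walk-periodic b i c) (cong (_+ c * period b) (walk-base b i<ℓ))

  -- At the last index of a period the successor is the start of the next one; there `base-closes`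
  -- identifies the two values.
  walk-next : ∀ b {i} → i < period b → ∀ c → walk b (suc i + c * period b) ≡ base b (suc i) + c * period b
  walk-next b {i} i<ℓ c with m≤n⇒m<n∨m≡n i<ℓ
  ... | inj₁ si<ℓ = walk-at b si<ℓ c
  ... | inj₂ si≡ℓ = begin
    walk b (suc i + c * ℓ) ≡⟨ cong (λ u → walk b (u + c * ℓ)) si≡ℓ ⟩
    walk b (0 + suc c * ℓ) ≡⟨ walk-at b (≤-<-trans z≤n i<ℓ) (suc c) ⟩
    base b 0 + (ℓ + c * ℓ) ≡⟨ +-assoc (base b 0) ℓ _ ⟨
    base b 0 + ℓ + c * ℓ   ≡⟨ cong (_+ c * ℓ) (trans (sym (base-closes b)) (cong (base b) (sym si≡ℓ))) ⟩
    base b (suc i) + c * ℓ ∎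
    where
    open ≡-Reasoning
    ℓ = period b

  -- The period divides `N`, so moving the index by `N` moves the value by `N`; thus `walk` is well
  -- defined on residues modulo `N`.
  walk-cong : ∀ b {i j} → i ≈ j [ N ] → walk b i ≈ walk b j [ N ]
  walk-cong b {i} {j} (offset k l eq) with divides e N≡ ← period∣N b = offset k l (begin
    walk b i + k * N       ≡⟨ fold i k ⟩
    walk b (i + k * N)     ≡⟨ cong (walk b) eq ⟩
    walk b (j + l * N)     ≡⟨ fold j l ⟨
    walk b j + l * N       ∎)
    where
    open ≡-Reasoning
    multiple : ∀ k → k * N ≡ k * e * period b
    multiple k = trans (cong (k *_) N≡) (sym (*-assoc k e _))
    fold : ∀ i k → walk b i + k * N ≡ walk b (i + k * N)
    fold i k rewrite multiple k = sym (walk-periodic b i (k * e))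

  -- Modulo the period, `base-injective` gives the same place in the period. Cancelling the equal
  -- base values then leaves the multiples of the period, which agree modulo `N`.
  walk-injective : ∀ b {i j} → walk b i ≈ walk b j [ N ] → i ≈ j [ N ]
  walk-injective b {i} {j} p = ≈-trans (≡⇒≈ (m≡m%n+[m/n]*n i ℓ)) (≈-trans
      (≈-+ (≡⇒≈ i%ℓ≡j%ℓ) (≈-cancelˡ p (≡⇒≈ (cong (base b) i%ℓ≡j%ℓ))))
      (≡⇒≈ (sym (m≡m%n+[m/n]*n j ℓ))))
    where
    ℓ = period b
    i%ℓ≡j%ℓ : i % ℓ ≡ j % ℓ
    i%ℓ≡j%ℓ = base-injective b (m%n<n i ℓ) (m%n<n j ℓ)
      (≈-cancelʳ (≈-coarsen (period∣N b) p) (≈-trans (multiple≈0 (i / ℓ)) (≈-sym (multiple≈0 (j / ℓ)))))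

  vertex : Orbit → ℕ → Fin N → Fin N
  vertex b j i = reduce i (walk b (toℕ i) + j)

  toℕ-vertex : ∀ b j i {u} → toℕ i ≈ u [ N ] → toℕ (vertex b j i) ≈ walk b u + j [ N ]
  toℕ-vertex b j i p = ≈-trans (toℕ-reduce i _) (≈-+ (walk-cong b p) ≈-refl)

  toℕ-next : ∀ (i : Fin N) {u} → toℕ i ≈ u [ N ] → toℕ (shift 1 i) ≈ suc u [ N ]
  toℕ-next i {u} p = ≈-trans (toℕ-shift 1 i) (≈-trans (≈-+ p ≈-refl) (≡⇒≈ (+-comm u 1)))

  -- Edges of the translates described by arithmetic.

  -- An edge directed from the lower end of its step, so that its difference is `len step` and not
  -- the negative. Translate `j` is invariant under the period, so the tail matters only modulo the
  -- period.
  record Arc (b : Orbit) (j : ℕ) (x y : Fin N) : Set where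
    constructor arc
    field
      step    : Step
      belongs : orbit step ≡ b
      tail    : toℕ x ≈ low step + j [ period b ]
      head    : toℕ x + len step ≈ toℕ y [ N ]

  Link : Orbit → ℕ → Fin N → Fin N → Set
  Link b j x y = ∃ λ i → vertex b j i ≡ x × vertex b j (shift 1 i) ≡ y

  link⇒arc : ∀ b j {x y} → Link b j x y → Arc b j x y ⊎ Arc b j y x
  link⇒arc b j {x} {y} (i , refl , refl) = orient (step-at b I I<ℓ)
    where
    ℓ = period b
    I = toℕ i % ℓ
    c = toℕ i / ℓ
    I<ℓ = m%n<n (toℕ i) ℓ
    i≈ : toℕ i ≈ I + c * ℓ [ N ]
    i≈ = ≡⇒≈ (m≡m%n+[m/n]*n (toℕ i) ℓ)
    x≈ : ∀ {u} → base b I ≡ u → toℕ x ≈ u + c * ℓ + j [ N ]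
    x≈ refl = ≈-trans (toℕ-vertex b j i i≈) (≡⇒≈ (cong (_+ j) (walk-at b I<ℓ c)))
    y≈ : ∀ {u} → base b (suc I) ≡ u → toℕ y ≈ u + c * ℓ + j [ N ]
    y≈ refl = ≈-trans (toℕ-vertex b j (shift 1 i) (toℕ-next i i≈)) (≡⇒≈ (cong (_+ j) (walk-next b I<ℓ c)))
    tail : ∀ {v u} → v ≈ u + c * ℓ + j [ N ] → v ≈ u + j [ ℓ ]
    tail {_} {u} p = ≈-trans (≈-coarsen (period∣N b) p)
      (≈-+ (≈-trans (≈-+ (≈-refl {u}) (multiple≈0 c)) (≡⇒≈ (+-identityʳ u))) ≈-refl)
    head : ∀ {v w u d} → v ≈ u + c * ℓ + j [ N ] → w ≈ u + d + c * ℓ + j [ N ] → v + d ≈ w [ N ]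
    head {u = u} {d} p q = ≈-trans (≈-+ p ≈-refl) (≈-trans (≡⇒≈ (lemma u (c * ℓ) j d)) (≈-sym q))
      where
      lemma : ∀ u e j d → u + e + j + d ≡ u + d + e + j
      lemma = solve-∀
    -- A step traversed downwards gives an arc against the direction of the walk.
    orient : (∃ λ s → orbit s ≡ b × Spans (low s) (len s) (base b I) (base b (suc I))) → Arc b j x y ⊎ Arc b j y x
    orient (s , o , inj₁ (p , q)) = inj₁ (arc s o (tail (x≈ p)) (head (x≈ p) (y≈ q)))
    orient (s , o , inj₂ (p , q)) = inj₂ (arc s o (tail (y≈ q)) (head (y≈ q) (x≈ p)))

  -- The second hypothesis says that `y` minus `x` is the difference of step `i`. The first
  -- determines, through `≈-refine`, the number `c` of periods to skip so that index `i + cℓ` lands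
  -- on `x`.
  link-at : ∀ b j {i} → i < period b → ∀ {x y : Fin N} → toℕ x ≈ base b i + j [ period b ] →
            toℕ x + base b (suc i) ≈ toℕ y + base b i [ N ] → Link b j x y
  link-at b j {i} i<ℓ {x} {y} p step with c , q ← ≈-refine (period∣N b) (≤-<-trans z≤n (toℕ<n x)) p =
    I , toℕ-≈-injective at , toℕ-≈-injective next
    where
    ℓ = period b
    I = reduce x (i + c * ℓ)
    I≈ : toℕ I ≈ i + c * ℓ [ N ]
    I≈ = toℕ-reduce x _
    x≈ : base b i + c * ℓ + j ≈ toℕ x [ N ]
    x≈ = ≈-trans (≡⇒≈ (lemma (base b i) (c * ℓ) j)) (≈-sym q)
      where
      lemma : ∀ u e j → u + e + j ≡ u + j + e
      lemma = solve-∀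
    at : toℕ (vertex b j I) ≈ toℕ x [ N ]
    at = ≈-trans (toℕ-vertex b j I I≈) (≈-trans (≡⇒≈ (cong (_+ j) (walk-at b i<ℓ c))) x≈)
    next : toℕ (vertex b j (shift 1 I)) ≈ toℕ y [ N ]
    next = ≈-cancelʳ (≈-trans (≈-+ (toℕ-vertex b j (shift 1 I) (toℕ-next I I≈)) (≈-refl {base b i}))
      (≈-trans (≡⇒≈ (trans (cong (λ w → w + j + base b i) (walk-next b i<ℓ c)) (lemma (base b (suc i)) (c * ℓ) j (base b i))))
      (≈-trans (≈-+ x≈ ≈-refl) step))) ≈-refl
      where
      lemma : ∀ v e j u → v + e + j + u ≡ u + e + j + v
      lemma = solve-∀

  arc⇒link : ∀ b j {x y} → Arc b j x y → Link b j x y ⊎ Link b j y x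
  arc⇒link b j {x} {y} (arc s refl tail head) with position s
  ... | i , i<ℓ , inj₁ (p , q) = inj₁ (link-at b j i<ℓ
    (subst (λ u → toℕ x ≈ u + j [ period b ]) (sym p) tail)
    (≈-trans (≡⇒≈ (trans (cong (toℕ x +_) q) (lemma (toℕ x) (low s) (len s)))) (≈-+ head (≡⇒≈ (sym p)))))
    where
    lemma : ∀ x l d → x + (l + d) ≡ x + d + l
    lemma = solve-∀
  ... | i , i<ℓ , inj₂ (p , q) = inj₂ (link-at b j i<ℓ
    (≈-trans (≈-sym (≈-coarsen (period∣N b) head)) (≈-trans (≈-+ tail ≈-refl)
      (≡⇒≈ (trans (lemma (low s) j (len s)) (cong (_+ j) (sym p))))))
    (≈-trans (≈-+ (≈-sym head) (≡⇒≈ q)) (≡⇒≈ (trans (lemma′ (toℕ x) (len s) (low s)) (cong (toℕ x +_) (sym p))))))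
    where
    lemma : ∀ l j d → l + j + d ≡ l + d + j
    lemma = solve-∀
    lemma′ : ∀ x d l → x + d + l ≡ x + (l + d)
    lemma′ = solve-∀

  cycle : Orbit → ℕ → HamCycle m n
  cycle b j = record
    { seq      = vertex b j
    ; distinct = λ {i} {i′} eq → toℕ-≈-injective (walk-injective b
        (≈-cancelʳ (≈-trans (≈-sym (toℕ-reduce i _)) (≈-trans (≡⇒≈ (cong toℕ eq)) (toℕ-reduce i′ _))) (≈-refl {j})))
    -- Ends congruent modulo `m` would make the difference of their arc divisible by `m`.
    ; adjacent = λ i m∣ → adjacent′ (∣∣-∣⇒≈ (toℕ (vertex b j i)) _ m∣) (link⇒arc b j (i , refl , refl))
    }
    where
    indivisible : ∀ {x y} → Arc b j x y → ¬ toℕ x ≈ toℕ y [ m ]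
    indivisible (arc s _ _ head) p = len-indivisible s
      (≈0⇒∣ (≈-cancelˡ (≈-trans (≈-coarsen (m∣m*n n) head) (≈-trans (≈-sym p) (≡⇒≈ (sym (+-identityʳ _))))) ≈-refl))
    adjacent′ : ∀ {x y} → toℕ x ≈ toℕ y [ m ] → ¬ (Arc b j x y ⊎ Arc b j y x)
    adjacent′ p (inj₁ a) = indivisible a p
    adjacent′ p (inj₂ a) = indivisible a (≈-sym p)

  edge⇒arc : ∀ b j {x y} → Edge (cycle b j) x y → Arc b j x y ⊎ Arc b j y x
  edge⇒arc b j (i , inj₁ e) = link⇒arc b j (i , e)
  edge⇒arc b j (i , inj₂ e) = ⊎-swap (link⇒arc b j (i , e))

  arc⇒edge : ∀ b j {x y} → Arc b j x y ⊎ Arc b j y x → Edge (cycle b j) x y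
  arc⇒edge b j (inj₁ a) with arc⇒link b j a
  ... | inj₁ (i , e) = i , inj₁ e
  ... | inj₂ (i , e) = i , inj₂ e
  arc⇒edge b j (inj₂ a) with arc⇒link b j a
  ... | inj₁ (i , e) = i , inj₂ e
  ... | inj₂ (i , e) = i , inj₁ e

  -- Adding `k` to both ends keeps the difference of an arc and moves its tail by `k`; only the
  -- residue of `j + k` modulo the period is seen.
  translate : ∀ b k {j j′} → j + k ≈ j′ [ period b ] → Translate k (cycle b j) (cycle b j′)
  translate b k {j} {j′} p x y = mk⇔
    (λ e → arc⇒edge b j′ (⊎-map forward forward (edge⇒arc b j e)))
    (λ e → arc⇒edge b j (⊎-map backward backward (edge⇒arc b j′ e)))
    where
    commute : ∀ (x : Fin N) d → toℕ x + d + k ≈ toℕ (shift k x) + d [ N ]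
    commute x d = ≈-trans (≡⇒≈ (lemma (toℕ x) d k)) (≈-+ (≈-sym (toℕ-shift k x)) ≈-refl)
      where
      lemma : ∀ x d k → x + d + k ≡ x + k + d
      lemma = solve-∀
    shift≈ : ∀ x → toℕ (shift k x) ≈ toℕ x + k [ period b ]
    shift≈ x = ≈-coarsen (period∣N b) (toℕ-shift k x)
    low≈ : ∀ s → low s + j + k ≈ low s + j′ [ period b ]
    low≈ s = ≈-trans (≡⇒≈ (+-assoc (low s) j k)) (≈-+ ≈-refl p)
    forward : ∀ {x y} → Arc b j x y → Arc b j′ (shift k x) (shift k y)
    forward {x} {y} (arc s o tail head) = arc s o
      (≈-trans (shift≈ x) (≈-trans (≈-+ tail ≈-refl) (low≈ s)))
      (≈-trans (≈-sym (commute x (len s))) (≈-trans (≈-+ head ≈-refl) (≈-sym (toℕ-shift k y))))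
    backward : ∀ {x y} → Arc b j′ (shift k x) (shift k y) → Arc b j x y
    backward {x} {y} (arc s o tail head) = arc s o
      (≈-cancelʳ (≈-trans (≈-sym (shift≈ x)) (≈-trans tail (≈-sym (low≈ s)))) ≈-refl)
      (≈-cancelʳ (≈-trans (commute x (len s)) (≈-trans head (toℕ-shift k y))) ≈-refl)

  -- Every edge lies in exactly one cycle.

  Index : Set
  Index = Σ Orbit λ b → Fin (period b)

  len<N : ∀ s → len s < N
  len<N s = ≤-<-trans (m≤m+n (len s) (len s)) (len-bound s)

  -- The ends determine the difference modulo `N`, hence the step and its orbit; the tail then
  -- determines the translate modulo the period.
  arc-unique : ∀ {c c′ : Index} {x y} → Arc (proj₁ c) (toℕ (proj₂ c)) x y → Arc (proj₁ c′) (toℕ (proj₂ c′)) x y → c ≡ c′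
  arc-unique {b , j} {b′ , j′} {x} {y} (arc s o tail head) (arc s′ o′ tail′ head′) = same s≡s′ o o′ tail′
    where
    s≡s′ : s ≡ s′
    s≡s′ = len-injective (≈⇒≡ (len<N s) (len<N s′) (≈-cancelˡ (≈-trans head (≈-sym head′)) (≈-refl {toℕ x})))
    same : ∀ {s′ b′} {j′ : Fin (period b′)} → s ≡ s′ → orbit s ≡ b → orbit s′ ≡ b′ →
           toℕ x ≈ low s′ + toℕ j′ [ period b′ ] → (b , j) ≡ (b′ , j′)
    same refl refl refl t = cong (b ,_) (toℕ-≈-injective (≈-cancelˡ (≈-trans (≈-sym tail) t) (≈-refl {low s})))

  -- Opposite arcs have differences with sum 0 modulo `N`. Both are below `N / 2`, so both vanish,
  -- although `m` divides no difference of a step.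
  arc-asym : ∀ {b j b′ j′ x y} → Arc b j x y → ¬ Arc b′ j′ y x
  arc-asym {x = x} {y} (arc s _ _ head) (arc s′ _ _ head′) =
    len-indivisible s (subst (m ∣_) (sym (m+n≡0⇒m≡0 (len s) sum≡0)) (m ∣0))
    where
    sum<N : len s + len s′ < N
    sum<N with ≤-total (len s) (len s′)
    ... | inj₁ ≤ = ≤-<-trans (+-monoˡ-≤ _ ≤) (len-bound s′)
    ... | inj₂ ≥ = ≤-<-trans (+-monoʳ-≤ _ ≥) (len-bound s)
    sum≡0 : len s + len s′ ≡ 0
    sum≡0 = ≈⇒≡ sum<N (≤-<-trans z≤n sum<N) (≈-cancelˡ
      (≈-trans (≡⇒≈ (sym (+-assoc (toℕ x) (len s) (len s′)))) (≈-trans (≈-+ head ≈-refl)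
        (≈-trans head′ (≡⇒≈ (sym (+-identityʳ (toℕ x))))))) ≈-refl)

  arc-from : ∀ s {x y} → toℕ x + len s ≈ toℕ y [ N ] → ∃ λ (c : Index) → Arc (proj₁ c) (toℕ (proj₂ c)) x y
  arc-from s {x} head = (b , fromℕ< j<ℓ) , arc s refl tail head
    where
    b = orbit s
    ℓ = period b
    -- r ≡ x − low s modulo ℓ
    r = toℕ x + low s * (ℓ ∸ 1)
    j<ℓ = m%n<n r ℓ
    lemma : ∀ l x ℓ′ → l + (x + l * ℓ′) ≡ x + l * suc ℓ′
    lemma = solve-∀
    tail : toℕ x ≈ low s + toℕ (fromℕ< j<ℓ) [ ℓ ]
    tail = ≈-sym (≈-trans (≈-+ (≈-refl {low s}) (≈-trans (≡⇒≈ (toℕ-fromℕ< j<ℓ)) (%-≈ r ℓ)))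
      (≈-trans (≡⇒≈ (trans (lemma (low s) (toℕ x) (ℓ ∸ 1)) (cong (λ u → toℕ x + low s * u) (suc-pred ℓ))))
      (≈-trans (≈-+ (≈-refl {toℕ x}) (multiple≈0 (low s))) (≡⇒≈ (+-identityʳ _)))))

  Arcs : Fin N → Fin N → Set
  Arcs x y = ∃ λ (c : Index) → Arc (proj₁ c) (toℕ (proj₂ c)) x y ⊎ Arc (proj₁ c) (toℕ (proj₂ c)) y x

  short-arc : ∀ {x y d} → toℕ x + d ≡ toℕ y → ¬ m ∣ d → d + d < N → Arcs x y
  short-arc {x} {y} x+d≡y m∤d d+d<N = forward (len-surjective _ m∤d d+d<N)
    where
    forward : (∃ λ s → len s ≡ _) → Arcs x y
    forward (s , len≡d) = map₂ inj₁ (arc-from s (≡⇒≈ (trans (cong (toℕ x +_) len≡d) x+d≡y)))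

  -- A difference above `N / 2` is read backwards: from `y` to `x` past `N`, with the complementary
  -- difference `e` below `N / 2`.
  long-arc : ∀ {x y d e} → toℕ x + d ≡ toℕ y → e + d ≡ N → ¬ m ∣ d → N < d + d → Arcs x y
  long-arc {x} {y} {d} {e} x+d≡y e+d≡N m∤d N<d+d = backward (len-surjective e m∤e e+e<N)
    where
    m∤e : ¬ m ∣ e
    m∤e m∣e = m∤d (∣m+n∣m⇒∣n (subst (m ∣_) (sym e+d≡N) (m∣m*n n)) m∣e)
    e<d : e < d
    e<d = +-cancelʳ-< d e d (subst (_< d + d) (sym e+d≡N) N<d+d)
    e+e<N : e + e < N
    e+e<N = subst (e + e <_) e+d≡N (+-monoʳ-< e e<d)
    y+e≈x : toℕ y + e ≈ toℕ x [ N ]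
    y+e≈x = offset 0 1 (begin
      toℕ y + e + 0       ≡⟨ +-identityʳ _ ⟩
      toℕ y + e           ≡⟨ cong (_+ e) x+d≡y ⟨
      toℕ x + d + e       ≡⟨ lemma (toℕ x) d e ⟩
      toℕ x + 1 * (e + d) ≡⟨ cong (λ u → toℕ x + 1 * u) e+d≡N ⟩
      toℕ x + 1 * N       ∎)
      where
      open ≡-Reasoning
      lemma : ∀ x d e → x + d + e ≡ x + 1 * (e + d)
      lemma = solve-∀
    backward : (∃ λ s → len s ≡ e) → Arcs x y
    backward (s , len≡e) = map₂ inj₂ (arc-from s (subst (λ l → toℕ y + l ≈ toℕ x [ N ]) (sym len≡e) y+e≈x))

  arc-exists : ∀ {x y : Fin N} → toℕ x ≤ toℕ y → Adj m n x y → Arcs x y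
  arc-exists {x} {y} x≤y m∤d = by-size (<-cmp (d + d) N)
    where
    d = ∣ toℕ x - toℕ y ∣
    d≤N : d ≤ N
    d≤N = ≤-trans (subst (d ≤_) (∣-∣-≤ x≤y) (m≤n+m d (toℕ x))) (<⇒≤ (toℕ<n y))
    by-size : Tri (d + d < N) (d + d ≡ N) (N < d + d) → Arcs x y
    by-size (tri< d+d<N _ _) = short-arc {x} {y} (∣-∣-≤ x≤y) m∤d d+d<N
    by-size (tri≈ _ d+d≡N _) = contradiction (half-divisible 2∣n d d+d≡N) m∤d
    by-size (tri> _ _ N<d+d) = long-arc {x} {y} (∣-∣-≤ x≤y) (m∸n+n≡m d≤N) m∤d N<d+d

  -- The three required properties of the system.

  module Enumerated {r : ℕ} (enum : Fin r ↔ Index) where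
    open Inverse enum using (to; from; strictlyInverseˡ; strictlyInverseʳ)

    cycles : Fin r → HamCycle m n
    cycles i = cycle (proj₁ (to i)) (toℕ (proj₂ (to i)))

    isHCS : IsHCS m n r cycles
    isHCS x y adj = (from (proj₁ found) , present) , unique
      where
      found : Arcs x y
      found with ≤-total (toℕ x) (toℕ y)
      ... | inj₁ x≤y = arc-exists x≤y adj
      ... | inj₂ y≤x = map₂ ⊎-swap (arc-exists y≤x (λ p → adj (subst (m ∣_) (∣-∣-comm (toℕ y) (toℕ x)) p)))
      present : Edge (cycles (from (proj₁ found))) x y
      present = subst (λ c → Edge (cycle (proj₁ c) (toℕ (proj₂ c))) x y) (sym (strictlyInverseˡ (proj₁ found)))
        (arc⇒edge _ _ (proj₂ found))
      to-injective : ∀ {i j} → to i ≡ to j → i ≡ j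
      to-injective {i} {j} p = trans (sym (strictlyInverseʳ i)) (trans (cong from p) (strictlyInverseʳ j))
      unique : ∀ i j → Edge (cycles i) x y → Edge (cycles j) x y → i ≡ j
      unique i j e e′ with edge⇒arc _ _ e | edge⇒arc _ _ e′
      ... | inj₁ a | inj₁ a′ = to-injective (arc-unique a a′)
      ... | inj₁ a | inj₂ a′ = contradiction a′ (arc-asym a)
      ... | inj₂ a | inj₁ a′ = contradiction a′ (arc-asym a)
      ... | inj₂ a | inj₂ a′ = to-injective (arc-unique a a′)

    -- Adding 1 permutes the translates of each base cycle cyclically: `shift 1` on `Fin (period b)`
    -- wraps from the last one to the first.
    isCyclic : IsCyclic m n r cycles
    isCyclic i with b , j ← to i = from (b , shift 1 j) ,
      subst (λ c → Translate 1 (cycle b (toℕ j)) (cycle (proj₁ c) (toℕ (proj₂ c)))) (sym (strictlyInverseˡ (b , shift 1 j)))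
        (translate b 1 (≈-sym (toℕ-shift 1 j)))

    -- The period divides `m`, so adding `m` leaves the index of the translate unchanged modulo the
    -- period.
    isPhiSymmetric : IsPhiSymmetric m n r cycles
    isPhiSymmetric i with b , j ← to i = translate b m
      (≈-trans (≈-+ (≈-refl {toℕ j}) (∣⇒≈0 (period∣m b))) (≡⇒≈ (+-identityʳ _)))

-- Zigzags.

n+n≡n*2 : ∀ n → n + n ≡ n * 2
n+n≡n*2 = solve-∀

isEven : ℕ → Bool
isEven zero    = true
isEven (suc i) = not (isEven i)

parity : ∀ i → (if isEven i then i else suc i) ≈ 0 [ 2 ]
parity zero = ≈-refl
parity (suc i) with isEven i | parity i
... | true  | p = ≈-trans (≈-+ (multiple≈0 1) p) ≈-refl
... | false | p = p

isEven-double : ∀ a → isEven (a + a) ≡ true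
isEven-double zero = refl
isEven-double (suc a) rewrite +-suc a a | isEven-double a = refl

-- The sequence `o`, `o + 2 + c`, `o - 2`, `o + 4 + c`, `o - 4`, and so on, whose successive
-- differences are `c + 2`, `c + 4`, `c + 6`, and so on.
zig : (o c i : ℕ) → ℕ
zig o c i = if isEven i then o ∸ i else o + suc i + c

zigLow : (o i : ℕ) → ℕ
zigLow o i = if isEven i then o ∸ i else o ∸ suc i

zig-step : ∀ {o i} c → i < o → Spans (zigLow o i) (suc i * 2 + c) (zig o c i) (zig o c (suc i))
zig-step {o} {i} c i<o with isEven i
... | true  = inj₁ (refl , (begin
  o + suc (suc i) + c           ≡⟨ cong (λ u → u + suc (suc i) + c) (m∸n+n≡m (<⇒≤ i<o)) ⟨
  o ∸ i + i + suc (suc i) + c   ≡⟨ lemma (o ∸ i) i c ⟩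
  o ∸ i + (suc i * 2 + c)       ∎))
  where
  open ≡-Reasoning
  lemma : ∀ z i c → z + i + (2 + i) + c ≡ z + ((1 + i) * 2 + c)
  lemma = solve-∀
... | false = inj₂ ((begin
  o + suc i + c                   ≡⟨ cong (λ u → u + suc i + c) (m∸n+n≡m i<o) ⟨
  o ∸ suc i + suc i + suc i + c   ≡⟨ lemma (o ∸ suc i) i c ⟩
  o ∸ suc i + (suc i * 2 + c)     ∎) , refl)
  where
  open ≡-Reasoning
  lemma : ∀ z i c → z + (1 + i) + (1 + i) + c ≡ z + ((1 + i) * 2 + c)
  lemma = solve-∀

zig-parity : ∀ {o i c} → i ≤ o → c ≈ 0 [ 2 ] → zig o c i ≈ o [ 2 ]
zig-parity {o} {i} {c} i≤o c≈0 with isEven i | parity i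
... | true  | p = ≈-cancelʳ (≡⇒≈ (trans (m∸n+n≡m i≤o) (sym (+-identityʳ o)))) p
... | false | p = ≈-trans (≈-+ (≈-trans (≈-+ (≈-refl {o}) p) (≡⇒≈ (+-identityʳ o))) c≈0) (≡⇒≈ (+-identityʳ o))

-- A coincidence of a descending and an ascending term would give `i + j + 1` congruent to 0 modulo
-- `2h`, while it lies strictly between 0 and `2h`.
opposite-zigs : ∀ {o c h i j} → h ≤ o → c ≈ 0 [ h * 2 ] → i < h → j < h → ¬ o ∸ i ≈ o + suc j + c [ h * 2 ]
opposite-zigs {o} {c} {h} {i} {j} h≤o c≈0 i<h j<h p = contradiction (≈⇒≡ sum<m (≤-<-trans z≤n sum<m) sum≈0) λ ()
  where
  sum<m : suc j + i < h * 2
  sum<m = subst (suc j + i <_) (n+n≡n*2 h) (+-mono-≤-< j<h i<h)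
  sum≈0 : suc j + i ≈ 0 [ h * 2 ]
  sum≈0 = ≈-cancelʳ {c = c} {d = 0} (≈-cancelˡ {c = o} {d = o}
    (≈-trans (≡⇒≈ (lemma o (suc j) i c)) (≈-trans (≈-+ (≈-sym p) (≈-refl {i}))
      (≡⇒≈ (trans (m∸n+n≡m (<⇒≤ (<-≤-trans i<h h≤o))) (sym (+-identityʳ o)))))) ≈-refl) c≈0
    where
    lemma : ∀ o j i c → o + (j + i + c) ≡ o + j + c + i
    lemma = solve-∀

-- On one side of `o` the distances from `o`, up to the multiple `c` of `2h`, are distinct and below
-- `2h`; opposite sides are kept apart by `opposite-zigs`.
zig-injective : ∀ {o c h i j} → h ≤ o → c ≈ 0 [ h * 2 ] → i < h → j < h → zig o c i ≈ zig o c j [ h * 2 ] → i ≡ j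
zig-injective {o} {c} {h} {i} {j} h≤o c≈0 i<h j<h p with isEven i | isEven j
... | true  | true  = ≈⇒≡ (m<n⇒m<n*o 2 i<h) (m<n⇒m<n*o 2 j<h)
  (≈-cancelˡ (≡⇒≈ (trans (m∸n+n≡m (<⇒≤ (<-≤-trans i<h h≤o))) (sym (m∸n+n≡m (<⇒≤ (<-≤-trans j<h h≤o)))))) p)
... | false | false = suc-injective (≈⇒≡ (≤-<-trans i<h h<m) (≤-<-trans j<h h<m)
  (≈-cancelˡ {c = o} (≈-cancelʳ p (≈-refl {c})) ≈-refl))
  where
  h<m : h < h * 2
  h<m = m<m*n h 2 {{>-nonZero (≤-<-trans z≤n i<h)}} (s≤s (s≤s z≤n))
... | true  | false = contradiction p (opposite-zigs h≤o c≈0 i<h j<h)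
... | false | true  = contradiction (≈-sym p) (opposite-zigs h≤o c≈0 j<h i<h)

-- Joining two zigzags, according to the parity of `h`.

stitch : ℕ → (ℕ → ℕ) → (ℕ → ℕ) → ℕ → ℕ
stitch h f g i with i <? h
... | yes _ = f i
... | no  _ = g (i ∸ h)

stitch-< : ∀ {h f g i} → i < h → stitch h f g i ≡ f i
stitch-< {h} {i = i} i<h with i <? h
... | yes _  = refl
... | no i≮h = contradiction i<h i≮h

stitch-+ : ∀ h {f g} i → stitch h f g (h + i) ≡ g i
stitch-+ h {g = g} i with h + i <? h
... | yes h+i<h = contradiction h+i<h (m+n≮m h i)
... | no _      = cong g (m+n∸m≡n h i)

data Half (h : ℕ) : ℕ → Set where
  first  : ∀ {i} → i < h → Half h i
  second : ∀ {i} → i < h → Half h (h + i)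

half : ∀ {h i} → i < h * 2 → Half h i
half {h} {i} i<m with i <? h
... | yes i<h = first i<h
... | no  i≮h = subst (Half h) (m+[n∸m]≡n (≮⇒≥ i≮h)) (second (+-cancelˡ-< h _ _
  (subst₂ _<_ (sym (m+[n∸m]≡n (≮⇒≥ i≮h))) (sym (n+n≡n*2 h)) i<m)))

-- There are h = 1 + a + upper t a even residues modulo m, so t tells whether h is even. The two zigzags start at
-- origin and turn; the closing difference is c + 1 + 2 · final, with lower end finalLow.
upper : Bool → ℕ → ℕ
upper false a = a
upper true  a = suc a

origin : Bool → (h c : ℕ) → ℕ
origin false h c = h * 2 + c
origin true  h c = h

turn : Bool → ℕ → ℕ
turn false w = suc w
turn true  w = suc w + w

final : Bool → ℕ → ℕ
final false w = suc w + w
final true  w = w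

finalLow : Bool → ℕ → ℕ
finalLow false w = 1
finalLow true  w = suc w + suc w * 2

h≤origin : ∀ t h c → h ≤ origin t h c
h≤origin false h c = ≤-trans (m≤m*n h 2) (m≤m+n (h * 2) c)
h≤origin true  h c = ≤-refl

h≤turn : ∀ t w → suc w ≤ turn t w
h≤turn false w = ≤-refl
h≤turn true  w = m≤m+n (suc w) w

double≤ : ∀ t a → a * 2 ≤ a + upper t a
double≤ false a = ≤-reflexive (sym (n+n≡n*2 a))
double≤ true  a = ≤-trans (double≤ false a) (+-monoʳ-≤ a (n≤1+n a))

upper-double≤ : ∀ t a → upper t a * 2 ≤ suc (a + upper t a)
upper-double≤ false a = m≤n⇒m≤1+n (double≤ false a)
upper-double≤ true  a = ≤-reflexive (lemma a)
  where
  lemma : ∀ a → (1 + a) * 2 ≡ 1 + (a + (1 + a))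
  lemma = solve-∀

-- Each increment of `w` raises the summands in turn, alternating between equal summands and
-- summands that differ by 1.
halve : ∀ w → ∃ λ t → ∃ λ a → w ≡ a + upper t a
halve zero = false , 0 , refl
halve (suc w) with halve w
... | false , a , refl = true , a , sym (+-suc a a)
... | true  , a , refl = false , suc a , refl

odd≉even : ∀ {x y} k l → x ≡ k * 2 → y ≡ suc (l * 2) → ¬ x ≈ y [ 2 ]
odd≉even k l refl refl p = contradiction
  (≈⇒≡ (s≤s z≤n) (s≤s (s≤s z≤n)) (≈-trans (≈-sym (multiple≈0 k)) (≈-trans p (≈-+ (≈-refl {1}) (multiple≈0 l))))) λ ()

-- A zigzag stays in one parity class, so this keeps the two zigzags disjoint: `origin` is even and
-- `turn` odd.
origin≉turn : ∀ t a {c} → 2 ∣ c → let w = a + upper t a in ¬ origin t (suc w) c ≈ turn t w [ 2 ]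
origin≉turn false a (divides q refl) = odd≉even (suc (a + a) + q) a (lemma (suc (a + a)) q) (lemma′ a)
  where
  lemma : ∀ h q → h * 2 + q * 2 ≡ (h + q) * 2
  lemma = solve-∀
  lemma′ : ∀ a → 1 + (a + a) ≡ 1 + a * 2
  lemma′ = solve-∀
origin≉turn true a _ = odd≉even (suc a) (a + suc a) (lemma a) (lemma′ (a + suc a))
  where
  lemma : ∀ a → 1 + (a + (1 + a)) ≡ (1 + a) * 2
  lemma = solve-∀
  lemma′ : ∀ w → (1 + w) + w ≡ 1 + w * 2
  lemma′ = solve-∀

-- The first zigzag ends on its descending side when `w` is even and on its ascending side when `w`
-- is odd. The starting points are chosen so that the jump to `turn` goes down by `c + 1` in both
-- cases.
middle-step : ∀ t a c → let w = a + upper t a in zig (origin t (suc w) c) c w ≡ turn t w + (1 + c)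
middle-step false a c rewrite isEven-double a = begin
  suc w * 2 + c ∸ w                ≡⟨ cong (_∸ w) (lemma w c) ⟩
  suc w + (1 + c) + w ∸ w          ≡⟨ m+n∸n≡m _ w ⟩
  suc w + (1 + c)                  ∎
  where
  open ≡-Reasoning
  w = a + a
  lemma : ∀ w c → (1 + w) * 2 + c ≡ (1 + w) + (1 + c) + w
  lemma = solve-∀
middle-step true a c rewrite +-suc a a | isEven-double a = lemma (suc (a + a)) c
  where
  lemma : ∀ w c → (1 + w) + (1 + w) + c ≡ (1 + w) + w + (1 + c)
  lemma = solve-∀

-- For odd `h` the second zigzag ends at 1 and the closing jump climbs by `c + 2m - 1`; for even `h`
-- it ends high and the jump descends by `c + m - 1`.
final-step : ∀ t a c → let w = a + upper t a ; m = suc w * 2 in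
             Spans (finalLow t w) (suc (final t w * 2) + c) (zig (turn t w) (m + c) w) (origin t (suc w) c + m)
final-step false a c rewrite isEven-double a = inj₁ (m+n∸n≡m 1 (a + a) , lemma (a + a) c)
  where
  lemma : ∀ w c → (1 + w) * 2 + c + (1 + w) * 2 ≡ 1 + ((1 + (1 + w + w) * 2) + c)
  lemma = solve-∀
final-step true a c rewrite +-suc a a | isEven-double a = inj₂ (lemma (suc (a + a)) c , refl)
  where
  lemma : ∀ w c → (1 + w) + w + (1 + w) + ((1 + w) * 2 + c) ≡ (1 + w) + (1 + w) * 2 + ((1 + w * 2) + c)
  lemma = solve-∀

-- The place of the closing jump among the odd differences.

final-positive : ∀ t a → 0 < final t (a + upper t a)
final-positive false a = s≤s z≤n
final-positive true  a rewrite +-suc a a = s≤s z≤n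

double<final : ∀ t a → a * 2 < final t (a + upper t a)
double<final false a = s≤s (≤-trans (double≤ false a) (m≤m+n (a + a) (a + a)))
double<final true  a rewrite +-suc a a = s≤s (double≤ false a)

final< : ∀ t w → final t w < suc w + suc w
final< false w = +-monoʳ-< (suc w) ≤-refl
final< true  w = m≤m+n (suc w) (suc w)

final≢upper : ∀ t a {e} → e < upper t a * 2 → let w = a + upper t a in final t w ≢ suc w + e
final≢upper false a e<2a eq = <⇒≢ (<-≤-trans e<2a (double≤ false a)) (sym (+-cancelˡ-≡ (suc (a + a)) _ _ eq))
final≢upper true  a e<2b eq = <⇒≢ (s≤s (m≤m+n _ _)) eq

combine-toℕ-injective : ∀ {a k} {p p′ : Fin a} {f f′ : Fin k} → toℕ (combine p f) ≡ toℕ (combine p′ f′) → p ≡ p′ × f ≡ f′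
combine-toℕ-injective {p = p} {p′} {f} {f′} eq = combine-injective p f p′ f′ (toℕ-injective eq)

combine-toℕ-surjective : ∀ {a k e} → e < a * k → ∃ λ (p : Fin a) → ∃ λ (f : Fin k) → toℕ (combine p f) ≡ e
combine-toℕ-surjective e< with p , f , eq ← combine-surjective (fromℕ< e<) = p , f , trans (cong toℕ eq) (toℕ-fromℕ< e<)

suc-double≢double : ∀ x y → suc (x * 2) ≢ y * 2
suc-double≢double x y eq = odd≉even y x refl refl (≡⇒≈ (sym eq))

-- For odd `h` the upper pairs follow the lower ones directly and the closing difference comes last;
-- for even `h` the closing difference sits between them, at `e = 0`.
beyond-lower : ∀ t a e → let w = a + upper t a in suc (a * 2) + e < suc w + suc w →
               suc (a * 2) + e ≡ final t w ⊎ (∃ λ e′ → e′ < upper t a * 2 × suc w + e′ ≡ suc (a * 2) + e)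
beyond-lower false a e bound with m≤n⇒m<n∨m≡n (+-cancelˡ-≤ (suc (a + a)) (suc e) (suc (a + a))
    (subst (_≤ suc (a + a) + suc (a + a)) (trans (cong (λ u → suc (suc u + e)) (sym (n+n≡n*2 a))) (sym (+-suc (suc (a + a)) e))) bound))
... | inj₁ e<w = inj₂ (e , subst (e <_) (n+n≡n*2 a) (s≤s⁻¹ e<w) , cong (λ u → suc u + e) (n+n≡n*2 a))
... | inj₂ e≡w = inj₁ (cong₂ (λ u v → suc u + v) (sym (n+n≡n*2 a)) (suc-injective e≡w))
beyond-lower true a zero bound = inj₁ (lemma a)
  where
  lemma : ∀ a → 1 + a * 2 + 0 ≡ a + (1 + a)
  lemma = solve-∀
beyond-lower true a (suc e) bound = inj₂ (e , +-cancelˡ-< (suc (a + suc a)) e _ (subst₂ _<_ (lemma a e) (lemma′ a) bound) , sym (lemma a e))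
  where
  lemma : ∀ a e → 1 + a * 2 + (1 + e) ≡ 1 + (a + (1 + a)) + e
  lemma = solve-∀
  lemma′ : ∀ a → 1 + (a + (1 + a)) + (1 + (a + (1 + a))) ≡ 1 + (a + (1 + a)) + (1 + a) * 2
  lemma′ = solve-∀

-- Differences within one block of length `2m`.

module Construction (K a : ℕ) (t : Bool) where

  b w h m n : ℕ
  b = upper t a
  w = a + b
  h = suc w
  m = h * 2
  n = K * 4

  data OddStep : Set where
    middle closing : OddStep
    pair           : Fin a ⊎ Fin b → Fin 2 → OddStep

  data Move : Set where
    inner₀ inner₁ : Fin w → Move
    odd           : OddStep → Move

  -- The `y` below `2h` with odd difference `c + 2y + 1`. Lower pairs fill 1 to `2a`, upper pairs
  -- fill `h` to `h + 2b - 1`, and the closing jump takes the one place left besides 0. Since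
  -- `combine p f` is `2p + f`, the two members of a pair are neighbours.
  oddHalf : OddStep → ℕ
  oddHalf middle            = 0
  oddHalf closing           = final t w
  oddHalf (pair (inj₁ p) f) = suc (toℕ (combine p f))
  oddHalf (pair (inj₂ p) f) = h + toℕ (combine p f)

  size : Move → ℕ
  size (inner₀ i) = suc (toℕ i) * 2
  size (inner₁ i) = (h + suc (toℕ i)) * 2
  size (odd o)    = suc (oddHalf o * 2)

  lower≤ : ∀ (p : Fin a) (f : Fin 2) → suc (toℕ (combine p f)) ≤ a * 2
  lower≤ p f = toℕ<n (combine p f)

  lower<h : ∀ (p : Fin a) (f : Fin 2) → suc (toℕ (combine p f)) < h
  lower<h p f = s≤s (≤-trans (lower≤ p f) (double≤ t a))

  oddHalf-injective : ∀ o o′ → oddHalf o ≡ oddHalf o′ → o ≡ o′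
  oddHalf-injective middle            middle             eq = refl
  oddHalf-injective middle            closing            eq = contradiction eq (<⇒≢ (final-positive t a))
  oddHalf-injective middle            (pair (inj₁ _) _)  ()
  oddHalf-injective middle            (pair (inj₂ _) _)  ()
  oddHalf-injective closing           middle             eq = contradiction (sym eq) (<⇒≢ (final-positive t a))
  oddHalf-injective closing           closing            eq = refl
  oddHalf-injective closing           (pair (inj₁ p) f)  eq = contradiction (sym eq) (<⇒≢ (≤-<-trans (lower≤ p f) (double<final t a)))
  oddHalf-injective closing           (pair (inj₂ p) f)  eq = contradiction eq (final≢upper t a (toℕ<n (combine p f)))
  oddHalf-injective (pair (inj₁ _) _) middle             ()
  oddHalf-injective (pair (inj₁ p) f) closing            eq = contradiction eq (<⇒≢ (≤-<-trans (lower≤ p f) (double<final t a)))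
  oddHalf-injective (pair (inj₁ p) f) (pair (inj₁ p′) f′) eq with refl , refl ← combine-toℕ-injective {p = p} {p′} {f} {f′} (suc-injective eq) = refl
  oddHalf-injective (pair (inj₁ p) f) (pair (inj₂ p′) f′) eq = contradiction eq (<⇒≢ (<-≤-trans (lower<h p f) (m≤m+n h _)))
  oddHalf-injective (pair (inj₂ _) _) middle             ()
  oddHalf-injective (pair (inj₂ p) f) closing            eq = contradiction (sym eq) (final≢upper t a (toℕ<n (combine p f)))
  oddHalf-injective (pair (inj₂ p) f) (pair (inj₁ p′) f′) eq = contradiction (sym eq) (<⇒≢ (<-≤-trans (lower<h p′ f′) (m≤m+n h _)))
  oddHalf-injective (pair (inj₂ p) f) (pair (inj₂ p′) f′) eq with refl , refl ← combine-toℕ-injective {p = p} {p′} {f} {f′} (+-cancelˡ-≡ h _ _ eq) = refl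

  size-injective : ∀ v v′ → size v ≡ size v′ → v ≡ v′
  size-injective (inner₀ i) (inner₀ i′) eq = cong inner₀ (toℕ-injective (suc-injective (*-cancelʳ-≡ _ _ 2 eq)))
  size-injective (inner₀ i) (inner₁ i′) eq =
    contradiction (*-cancelʳ-≡ _ (h + suc (toℕ i′)) 2 eq) (<⇒≢ (<-≤-trans (s≤s (toℕ<n i)) (m≤m+n h _)))
  size-injective (inner₁ i) (inner₀ i′) eq =
    contradiction (*-cancelʳ-≡ _ (h + suc (toℕ i)) 2 (sym eq)) (<⇒≢ (<-≤-trans (s≤s (toℕ<n i′)) (m≤m+n h _)))
  size-injective (inner₁ i) (inner₁ i′) eq =
    cong inner₁ (toℕ-injective (suc-injective (+-cancelˡ-≡ h _ _ (*-cancelʳ-≡ (h + suc (toℕ i)) _ 2 eq))))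
  size-injective (inner₀ i) (odd o)     eq = contradiction (sym eq) (suc-double≢double (oddHalf o) (suc (toℕ i)))
  size-injective (inner₁ i) (odd o)     eq = contradiction (sym eq) (suc-double≢double (oddHalf o) (h + suc (toℕ i)))
  size-injective (odd o)    (inner₀ i)  eq = contradiction eq (suc-double≢double (oddHalf o) (suc (toℕ i)))
  size-injective (odd o)    (inner₁ i)  eq = contradiction eq (suc-double≢double (oddHalf o) (h + suc (toℕ i)))
  size-injective (odd o)    (odd o′)    eq = cong odd (oddHalf-injective o o′ (*-cancelʳ-≡ _ _ 2 (suc-injective eq)))

  -- Halving an even size reduces the claim to `h` not dividing a number strictly between 0 and `h`,
  -- up to adding `h`. An odd size is no multiple of the even number `m`.
  size-indivisible : ∀ v → ¬ m ∣ size v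
  size-indivisible (inner₀ i) m∣ = >⇒∤ (s≤s (toℕ<n i)) (*-cancelʳ-∣ {h} 2 m∣)
  size-indivisible (inner₁ i) m∣ = >⇒∤ (s≤s (toℕ<n i)) (∣m+n∣m⇒∣n (*-cancelʳ-∣ {h} {h + suc (toℕ i)} 2 m∣) ∣-refl)
  size-indivisible (odd o)    m∣ with divides q eq ← ∣-trans (n∣m*n h) m∣ = suc-double≢double (oddHalf o) q eq

  oddHalf< : ∀ o → oddHalf o < h + h
  oddHalf< middle            = s≤s z≤n
  oddHalf< closing           = final< t w
  oddHalf< (pair (inj₁ p) f) = <-≤-trans (lower<h p f) (m≤m+n h h)
  oddHalf< (pair (inj₂ p) f) = +-monoʳ-< h (<-≤-trans (toℕ<n (combine p f)) (upper-double≤ t a))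

  double-bound : (h + h) * 2 ≡ m * 2
  double-bound = lemma h
    where
    lemma : ∀ h → (h + h) * 2 ≡ h * 2 * 2
    lemma = solve-∀

  size< : ∀ v → size v < m * 2
  size< (inner₀ i) = subst (size (inner₀ i) <_) double-bound (*-monoˡ-< 2 (<-≤-trans (s≤s (toℕ<n i)) (m≤m+n h h)))
  size< (inner₁ i) = subst (size (inner₁ i) <_) double-bound (*-monoˡ-< 2 (+-monoʳ-< h (s≤s (toℕ<n i))))
  size< (odd o)    = subst (size (odd o) <_) double-bound (*-monoˡ-≤ 2 (oddHalf< o))

  oddHalf-surjective : ∀ y → y < h + h → ∃ λ o → oddHalf o ≡ y
  oddHalf-surjective zero    _     = middle , refl
  oddHalf-surjective (suc e) bound with e <? a * 2
  ... | yes e<2a with p , f , eq ← combine-toℕ-surjective e<2a = pair (inj₁ p) f , cong suc eq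
  ... | no  e≮2a with beyond-lower t a (e ∸ a * 2) (subst (λ u → suc u < h + h) (sym (m+[n∸m]≡n (≮⇒≥ e≮2a))) bound)
  ...   | inj₁ eq = closing , trans (sym eq) (cong suc (m+[n∸m]≡n (≮⇒≥ e≮2a)))
  ...   | inj₂ (e′ , e′<2b , eq) with p , f , eq′ ← combine-toℕ-surjective e′<2b =
    pair (inj₂ p) f , trans (cong (h +_) eq′) (trans eq (cong suc (m+[n∸m]≡n (≮⇒≥ e≮2a))))

  even-surjective : ∀ y → y < h + h → ¬ m ∣ y * 2 → ∃ λ v → size v ≡ y * 2
  even-surjective y y< m∤ with half {h} (subst (y <_) (n+n≡n*2 h) y<)
  -- The even differences 0 and `m`, at `y = 0` and `y = h`, are those excluded by indivisibility.
  ... | first {zero} _           = contradiction (m ∣0) m∤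
  ... | first {suc i} (s≤s i<w)  = inner₀ (fromℕ< i<w) , cong (λ u → suc u * 2) (toℕ-fromℕ< i<w)
  ... | second {zero} _          = contradiction (subst (m ∣_) (cong (_* 2) (sym (+-identityʳ h))) ∣-refl) m∤
  ... | second {suc i} (s≤s i<w) = inner₁ (fromℕ< i<w) , cong (λ u → (h + suc u) * 2) (toℕ-fromℕ< i<w)

  size-surjective : ∀ d → d < m * 2 → ¬ m ∣ d → ∃ λ v → size v ≡ d
  size-surjective d d< m∤d = by-parity (d % 2) (d / 2) (m%n<n d 2) (m≡m%n+[m/n]*n d 2)
    where
    by-parity : ∀ r y → r < 2 → d ≡ r + y * 2 → ∃ λ v → size v ≡ d
    by-parity zero y _ refl = even-surjective y (*-cancelʳ-< 2 y (h + h) (subst (y * 2 <_) (sym double-bound) d<)) m∤d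
    by-parity (suc zero) y _ refl
      with o , eq ← oddHalf-surjective y (*-cancelʳ-< 2 y (h + h) (subst (y * 2 <_) (sym double-bound) (<-trans (n<1+n _) d<))) =
      odd o , cong (λ u → suc (u * 2)) eq
    by-parity (suc (suc _)) _ (s≤s (s≤s ())) _

  -- The explicit base cycles.

  data Kind : Set where
    zigzag : Kind
    paired : Fin a ⊎ Fin b → Kind

  Orbit Step : Set
  Orbit = Fin K × Kind
  Step  = Fin K × Move

  period : Orbit → ℕ
  period (_ , zigzag)   = m
  period (_ , paired _) = 2

  block : Fin K → ℕ
  block k = toℕ k * (m * 2)

  len : Step → ℕ
  len (k , v) = size v + block k

  -- Using `m + c` in the second zigzag makes its differences start at `c + m + 2`. The constant
  -- third piece is needed at index `m`, where the next period starts.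
  zigzagBase : ℕ → ℕ → ℕ
  zigzagBase c = stitch h (zig (origin t h c) c) (stitch h (zig (turn t w) (m + c)) (λ _ → origin t h c + m))

  -- Here `l` is the smaller difference of the pair: the sequence climbs by `l + 2` and falls by
  -- `l`, a net gain of the period 2.
  pairedBase : ℕ → ℕ → ℕ
  pairedBase l zero          = 0
  pairedBase l (suc zero)    = 2 + l
  pairedBase l (suc (suc _)) = 2

  base : Orbit → ℕ → ℕ
  base (k , zigzag)   = zigzagBase (block k)
  base (k , paired q) = pairedBase (len (k , odd (pair q zero)))

  orbit : Step → Orbit
  orbit (k , odd (pair q _)) = k , paired q
  orbit (k , _)              = k , zigzag

  low : Step → ℕ
  low (k , inner₀ i)                = zigLow (origin t h (block k)) (toℕ i)
  low (k , inner₁ i)                = zigLow (turn t w) (toℕ i)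
  low (k , odd middle)              = turn t w
  low (k , odd closing)             = finalLow t w
  -- The smaller difference belongs to the descent from `2 + l`, which ends at 2.
  low (k , odd (pair _ zero))       = 2
  low (k , odd (pair _ (suc zero))) = 0

  zigzag-first : ∀ c {i} → i < h → zigzagBase c i ≡ zig (origin t h c) c i
  zigzag-first c i<h = stitch-< i<h

  zigzag-second : ∀ c {i} → i < h → zigzagBase c (h + i) ≡ zig (turn t w) (m + c) i
  zigzag-second c {i} i<h = trans (stitch-+ h i) (stitch-< i<h)

  zigzag-end : ∀ c → zigzagBase c (h + h) ≡ origin t h c + m
  zigzag-end c = trans (stitch-+ h h) (trans (cong (stitch h _ _) (sym (+-identityʳ h))) (stitch-+ h 0))

  2∣block : ∀ k → 2 ∣ block k
  2∣block k = ∣-trans (n∣m*n m) (n∣m*n (toℕ k))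

  m∣block : ∀ k → m ∣ block k
  m∣block k = ∣-trans (m∣m*n 2) (n∣m*n (toℕ k))

  first-step : ∀ k (i : Fin w) → Spans (low (k , inner₀ i)) (len (k , inner₀ i)) (base (k , zigzag) (toℕ i)) (base (k , zigzag) (suc (toℕ i)))
  first-step k i = subst₂ (Spans _ _) (sym (zigzag-first c (m≤n⇒m≤1+n (toℕ<n i)))) (sym (zigzag-first c (s≤s (toℕ<n i))))
    (zig-step c (≤-trans (m≤n⇒m≤1+n (toℕ<n i)) (h≤origin t h c)))
    where c = block k

  second-step : ∀ k (i : Fin w) → Spans (low (k , inner₁ i)) (len (k , inner₁ i)) (base (k , zigzag) (h + toℕ i)) (base (k , zigzag) (suc (h + toℕ i)))
  second-step k i = subst₂ (Spans _ _) (sym (zigzag-second c (m≤n⇒m≤1+n (toℕ<n i))))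
    (trans (sym (zigzag-second c (s≤s (toℕ<n i)))) (cong (zigzagBase c) (+-suc h (toℕ i))))
    (subst (λ l → Spans (low (k , inner₁ i)) l (zig (turn t w) (m + c) (toℕ i)) (zig (turn t w) (m + c) (suc (toℕ i)))) (lemma h (suc (toℕ i)) c)
      (zig-step (m + c) (≤-trans (m≤n⇒m≤1+n (toℕ<n i)) (h≤turn t w))))
    where
    c = block k
    lemma : ∀ h i c → i * 2 + (h * 2 + c) ≡ (h + i) * 2 + c
    lemma = solve-∀

  turning-step : ∀ k → Spans (low (k , odd middle)) (len (k , odd middle)) (base (k , zigzag) w) (base (k , zigzag) h)
  turning-step k = inj₂ (trans (zigzag-first c (n<1+n w)) (middle-step t a c) ,
    trans (cong (zigzagBase c) (sym (+-identityʳ h))) (zigzag-second c {0} (s≤s z≤n)))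
    where c = block k

  closing-step : ∀ k → Spans (low (k , odd closing)) (len (k , odd closing)) (base (k , zigzag) (h + w)) (base (k , zigzag) (suc (h + w)))
  closing-step k = subst₂ (Spans _ _) (sym (zigzag-second c (n<1+n w)))
    (trans (sym (zigzag-end c)) (cong (zigzagBase c) (+-suc h w))) (final-step t a c)
    where c = block k

  long-len : ∀ k q → len (k , odd (pair q (suc zero))) ≡ 2 + len (k , odd (pair q zero))
  long-len k q = cong (λ u → suc (u * 2) + block k) (oddHalf-suc q)
    where
    combine-suc : ∀ {a} (p : Fin a) → toℕ (combine p (suc (zero {0}))) ≡ suc (toℕ (combine p (zero {1})))
    combine-suc p = trans (toℕ-combine p (suc zero)) (trans (+-suc _ 0) (cong suc (sym (toℕ-combine p (zero {1})))))
    oddHalf-suc : ∀ q → oddHalf (pair q (suc zero)) ≡ suc (oddHalf (pair q zero))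
    oddHalf-suc (inj₁ p) = cong suc (combine-suc p)
    oddHalf-suc (inj₂ p) = trans (cong (h +_) (combine-suc p)) (+-suc h _)

  StepAt : Orbit → ℕ → Set
  StepAt b i = ∃ λ s → orbit s ≡ b × Spans (low s) (len s) (base b i) (base b (suc i))

  step-at : ∀ b i → i < period b → StepAt b i
  step-at (k , paired q) zero          _ = (k , odd (pair q (suc zero))) , refl , inj₁ (refl , sym (long-len k q))
  step-at (k , paired q) (suc zero)    _ = (k , odd (pair q zero)) , refl , inj₂ (refl , refl)
  step-at (k , paired q) (suc (suc _)) (s≤s (s≤s ()))
  step-at (k , zigzag)   i             i<m with half {h} i<m
  -- In each half the last index `w` is no zigzag step but a jump: `middle` after the first half,
  -- `closing` after the second.
  ... | first {i} (s≤s i≤w) with m≤n⇒m<n∨m≡n i≤w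
  ...   | inj₁ i<w  = subst (StepAt (k , zigzag)) (toℕ-fromℕ< i<w) ((k , inner₀ (fromℕ< i<w)) , refl , first-step k (fromℕ< i<w))
  ...   | inj₂ refl = (k , odd middle) , refl , turning-step k
  step-at (k , zigzag)   i             i<m | second {i′} (s≤s i≤w) with m≤n⇒m<n∨m≡n i≤w
  ...   | inj₁ i<w  = subst (λ i → StepAt (k , zigzag) (h + i)) (toℕ-fromℕ< i<w) ((k , inner₁ (fromℕ< i<w)) , refl , second-step k (fromℕ< i<w))
  ...   | inj₂ refl = (k , odd closing) , refl , closing-step k

  h+<m : ∀ {i} → i < h → h + i < m
  h+<m {i} i<h = subst (h + i <_) (n+n≡n*2 h) (+-monoʳ-< h i<h)

  h≤m : h ≤ m
  h≤m = m≤m*n h 2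

  position : ∀ s → ∃ λ i → i < period (orbit s) × Spans (low s) (len s) (base (orbit s) i) (base (orbit s) (suc i))
  position (k , inner₀ i)                = toℕ i , <-≤-trans (m≤n⇒m≤1+n (toℕ<n i)) h≤m , first-step k i
  position (k , inner₁ i)                = h + toℕ i , h+<m (m≤n⇒m≤1+n (toℕ<n i)) , second-step k i
  position (k , odd middle)              = w , h≤m , turning-step k
  position (k , odd closing)             = h + w , h+<m (n<1+n w) , closing-step k
  position (k , odd (pair q zero))       = 1 , s≤s (s≤s z≤n) , inj₂ (refl , refl)
  position (k , odd (pair q (suc zero))) = 0 , s≤s z≤n , inj₁ (refl , sym (long-len k q))

  -- A congruence modulo the even `m` descends to parities, where the zigzags have those of `origin`
  -- and `turn`.
  separate : ∀ k {i j} → i < h → j < h → ¬ base (k , zigzag) i ≈ base (k , zigzag) (h + j) [ m ]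
  separate k {i} {j} i<h j<h p = origin≉turn t a (2∣block k)
    (≈-trans (≈-sym (zig-parity (<⇒≤ (<-≤-trans i<h (h≤origin t h c))) (∣⇒≈0 (2∣block k))))
    (≈-trans (≈-coarsen (n∣m*n h) (subst₂ (_≈_[ m ]) (zigzag-first c i<h) (zigzag-second c j<h) p))
      (zig-parity (<⇒≤ (<-≤-trans j<h (h≤turn t w))) (∣⇒≈0 (∣m∣n⇒∣m+n (n∣m*n h) (2∣block k))))))
    where c = block k

  paired-separate : ∀ k q → ¬ base (k , paired q) 0 ≈ base (k , paired q) 1 [ 2 ]
  paired-separate k q = odd≉even 0 (1 + oddHalf (pair q zero) + toℕ k * m) refl (lemma (oddHalf (pair q zero)) (toℕ k) m)
    where
    lemma : ∀ x k m → 2 + (1 + x * 2 + k * (m * 2)) ≡ 1 + (1 + x + k * m) * 2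
    lemma = solve-∀

  base-injective : ∀ b {i j} → i < period b → j < period b → base b i ≈ base b j [ period b ] → i ≡ j
  base-injective (k , zigzag) i<m j<m p with half {h} i<m | half {h} j<m
  ... | first i<h  | first j<h  = zig-injective (h≤origin t h (block k)) (∣⇒≈0 (m∣block k)) i<h j<h
    (subst₂ (_≈_[ m ]) (zigzag-first (block k) i<h) (zigzag-first (block k) j<h) p)
  ... | first i<h  | second j<h = contradiction p (separate k i<h j<h)
  ... | second i<h | first j<h  = contradiction (≈-sym p) (separate k j<h i<h)
  ... | second i<h | second j<h = cong (h +_) (zig-injective (h≤turn t w) (∣⇒≈0 (∣m∣n⇒∣m+n ∣-refl (m∣block k))) i<h j<h
    (subst₂ (_≈_[ m ]) (zigzag-second (block k) i<h) (zigzag-second (block k) j<h) p))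
  base-injective (k , paired q) {zero}        {zero}        _ _ _ = refl
  base-injective (k , paired q) {zero}        {suc zero}    _ _ p = contradiction p (paired-separate k q)
  base-injective (k , paired q) {suc zero}    {zero}        _ _ p = contradiction (≈-sym p) (paired-separate k q)
  base-injective (k , paired q) {suc zero}    {suc zero}    _ _ _ = refl
  base-injective (k , paired q) {suc (suc _)} {_}           (s≤s (s≤s ())) _ _
  base-injective (k , paired q) {_}           {suc (suc _)} _ (s≤s (s≤s ())) _

  -- The differences of all blocks together.

  -- Sizes lie below `2m` and blocks are multiples of `2m`, so size and block are remainder and
  -- quotient; `len-surjective` uses the same division.
  len-injective : ∀ {s s′} → len s ≡ len s′ → s ≡ s′
  len-injective {k , v} {k′ , v′} eq with refl ← size-injective v v′ (≈⇒≡ (size< v) (size< v′) (offset (toℕ k) (toℕ k′) eq)) =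
    cong (_, v) (toℕ-injective (*-cancelʳ-≡ (toℕ k) (toℕ k′) (m * 2) (+-cancelˡ-≡ (size v) _ _ eq)))

  -- This is where `n = 4K` enters: `K` blocks of length `2m` reach exactly `N / 2`.
  double-blocks : K * (m * 2) + K * (m * 2) ≡ m * n
  double-blocks = lemma K m
    where
    lemma : ∀ K m → K * (m * 2) + K * (m * 2) ≡ m * (K * 4)
    lemma = solve-∀

  len-bound : ∀ s → len s + len s < m * n
  len-bound s@(k , v) = subst (len s + len s <_) double-blocks (+-mono-< len< len<)
    where
    len< : len s < K * (m * 2)
    len< = <-≤-trans (+-monoˡ-< (block k) (size< v)) (*-monoˡ-≤ (m * 2) (toℕ<n k))

  len-indivisible : ∀ s → ¬ m ∣ len s
  len-indivisible (k , v) m∣ = size-indivisible v (∣m+n∣m⇒∣n (subst (m ∣_) (+-comm (size v) (block k)) m∣) (m∣block k))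

  len-surjective : ∀ d → ¬ m ∣ d → d + d < m * n → ∃ λ s → len s ≡ d
  len-surjective d m∤d d+d< = located (size-surjective r (m%n<n d (m * 2)) m∤r)
    where
    r = d % (m * 2)
    q = d / (m * 2)
    d≡ : d ≡ r + q * (m * 2)
    d≡ = m≡m%n+[m/n]*n d (m * 2)
    m∤r : ¬ m ∣ r
    m∤r m∣r = m∤d (subst (m ∣_) (sym d≡) (∣m∣n⇒∣m+n m∣r (∣-trans (m∣m*n 2) (n∣m*n q))))
    d< : d < K * (m * 2)
    d< = ≰⇒> λ K≤d → <⇒≱ d+d< (subst (_≤ d + d) double-blocks (+-mono-≤ K≤d K≤d))
    q<K : q < K
    q<K = m<n*o⇒m/o<n d<
    located : (∃ λ v → size v ≡ r) → ∃ λ s → len s ≡ d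
    located (v , eq) = (fromℕ< q<K , v) , trans (cong₂ (λ x y → x + y * (m * 2)) eq (toℕ-fromℕ< q<K)) (sym d≡)

  period-nonZero : ∀ b → NonZero (period b)
  period-nonZero (_ , zigzag)   = _
  period-nonZero (_ , paired _) = _

  period∣m : ∀ b → period b ∣ m
  period∣m (_ , zigzag)   = ∣-refl
  period∣m (_ , paired _) = n∣m*n h

  base-closes : ∀ b → base b (period b) ≡ base b 0 + period b
  base-closes (k , zigzag)   = trans (cong (zigzagBase (block k)) (sym (n+n≡n*2 h)))
    (trans (zigzag-end (block k)) (cong (_+ m) (sym (zigzag-first (block k) {0} (s≤s z≤n)))))
  base-closes (k , paired _) = refl

  baseCycles : BaseCycles m n
  baseCycles = record
    { Orbit = Orbit ; Step = Step
    ; period = period ; period-nonZero = period-nonZero ; period∣m = period∣m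
    ; base = base ; base-closes = base-closes ; base-injective = base-injective
    ; orbit = orbit ; low = low ; len = len ; step-at = step-at ; position = position
    ; len-injective = len-injective ; len-surjective = len-surjective
    ; len-indivisible = len-indivisible ; len-bound = len-bound
    }

  -- Each of the `K` blocks contributes the `m` translates of its zigzag cycle and 2 translates of
  -- each of its `a + b` paired cycles.
  enumeration : Fin (K * (m + (a + b) * 2)) ↔ Σ Orbit λ b → Fin (period b)
  enumeration = regroup ↔-∘ ((↔-id _ ×-↔ ((↔-id _ ⊎-↔ ((+↔⊎ ×-↔ ↔-id _) ↔-∘ *↔×)) ↔-∘ +↔⊎)) ↔-∘ *↔×)
    where
    regroup : (Fin K × (Fin m ⊎ ((Fin a ⊎ Fin b) × Fin 2))) ↔ Σ Orbit λ b → Fin (period b)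
    regroup = mk↔ₛ′
      (λ { (k , inj₁ j) → (k , zigzag) , j ; (k , inj₂ (q , j)) → (k , paired q) , j })
      (λ { ((k , zigzag) , j) → k , inj₁ j ; ((k , paired q) , j) → k , inj₂ (q , j) })
      (λ { ((k , zigzag) , j) → refl ; ((k , paired q) , j) → refl })
      (λ { (k , inj₁ j) → refl ; (k , inj₂ (q , j)) → refl })

  2∣n : 2 ∣ n
  2∣n = divides (K * 2) (lemma K)
    where
    lemma : ∀ K → K * 4 ≡ K * 2 * 2
    lemma = solve-∀

  system : ∃ λ r → Σ (Fin r → HamCycle m n) λ cs → IsHCS m n r cs × IsCyclic m n r cs × IsPhiSymmetric m n r cs
  system = _ , cycles , isHCS , isCyclic , isPhiSymmetric
    where open Develop.Enumerated 2∣n baseCycles enumeration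

theorem4p4 : (m n : ℕ) → 2 ≤ m → 2 ∣ m → 1 ≤ n → 4 ∣ n →
    ∃ λ r → Σ (Fin r → HamCycle m n) λ cs →
    IsHCS m n r cs × IsCyclic m n r cs × IsPhiSymmetric m n r cs
theorem4p4 _ _ ()  (divides zero refl)    _ _
-- Here `w` is `h - 1`, and splitting it by `halve` brings `m` and `n` literally into the form used
-- by `Construction`.
theorem4p4 _ _ _   (divides (suc w) refl) _ (divides K refl) with t , a , refl ← halve w = Construction.system K a t
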